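{- Let $f:2^V\to\mathbb{R}$ be an intersecting submodular and intersecting posimodular function on a finite set $V$, let $s$ be an element outside $V$, and let $g$ be the antirestriction of $f$, i.e. the function on subsets $X$ of $V+s=V\cup\{s\}$ defined by $g(X)=f(X)$ if $s\notin X$ and $g(X)=f(V\setminus X)$ if $s\in X$. Then $g$ is a symmetric and crossing submodular function on $V+s$. Moreover, for any hereditary family $\mathcal{I}$ on $V$, the set of optimal solutions of the system $(V,f,\mathcal{I})$ is the same as the set of optimal solutions of the system $(V+s,g,\mathcal{I})$; and so all the minimal optimal solutions of $(V,f,\mathcal{I})$ can be found by applying to $(V+s,g,\mathcal{I})$ an algorithm that finds all minimal optimal solutions for symmetric and crossing submodular functions under hereditary family constraints.
   Context: Two sets $A,B\subseteq V$ are intersecting if $A\setminus B$, $B\setminus A$ and $A\cap B$ are all nonempty. A function $f:2^V\to\mathbb{R}$ is intersecting submodular if $f(A\cup B)+f(A\cap B)\le f(A)+f(B)$ for every pair of intersecting subsets $A,B$ of $V$, and intersecting posimodular if $f(A\setminus B)+f(B\setminus A)\le f(A)+f(B)$ for every pair of intersecting subsets $A,B$ of $V$. For a finite set $W$, two sets $A,B\subseteq W$ are crossing if $A\setminus B$, $B\setminus A$, $A\cap B$ and $W\setminus(A\cup B)$ are all nonempty; a function $g:2^W\to\mathbb{R}$ is crossing submodular if $g(A\cup B)+g(A\cap B)\le g(A)+g(B)$ for every pair of crossing subsets $A,B$ of $W$, and symmetric if $g(A)=g(W\setminus A)$ for all $A\subseteq W$. A family $\mathcal{I}$ of subsets of a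 set is hereditary if every subset of a member of $\mathcal{I}$ is a member of $\mathcal{I}$. An optimal solution of a system $(W,h,\mathcal{I})$ (a finite set $W$, a function $h:2^W\to\mathbb{R}$, a hereditary family $\mathcal{I}$ of subsets of $W$) is a nonempty set $A^*\in\mathcal{I}$ minimizing $h$ over the nonempty sets in $\mathcal{I}$; it is a minimal optimal solution if no proper subset of it is also an optimal solution. The algorithm referred to is one that, given a symmetric and crossing submodular function on a finite set $W$ by a value oracle and a hereditary family of subsets of $W$, finds the collection of all minimal optimal solutions using $O(|W|^3)$ calls to the value oracle of that function. -}

module Defs where

open import Data.Fin.Subset
  using (Subset; inside; outside; Nonempty; _⊆_; _⊂_; _∩_; _∪_; _─_; ∁)
open import Data.List using (List)
open import Data.List.Membership.Propositional using () renaming (_∈_ to _∈ˡ_)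
open import Data.Nat as ℕ using (ℕ; suc)
import Data.Nat.Properties as ℕ
open import Data.Product using (∃; ∃₂; _×_; _,_)
open import Data.Rational as ℚ using (ℚ; 0ℚ; ½; ∣_∣)
import Data.Rational.Properties as ℚ
open import Data.Rational.Solver using (module +-*-Solver)
open import Data.Vec using (Vec; []; _∷_)
open import Level using (0ℓ)
open import Relation.Binary.PropositionalEquality using (_≡_; refl; subst)
open import Relation.Nullary using (¬_)
open import Relation.Unary using (Pred; _≐_)

-- Real numbers: Cauchy sequences of rationals, with the order and equality
-- of their limits.

IsCauchy : (ℕ → ℚ) → Set
IsCauchy a = ∀ ε → 0ℚ ℚ.< ε →
  ∃ λ N → ∀ m n → N ℕ.≤ m → N ℕ.≤ n → ∣ a m ℚ.- a n ∣ ℚ.< ε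

record ℝ : Set where
  constructor mkℝ
  field
    seq    : ℕ → ℚ
    cauchy : IsCauchy seq

open ℝ public

infixl 6 _+_
infix  4 _≤_ _≈_

+-isCauchy : ∀ a b → IsCauchy a → IsCauchy b → IsCauchy (λ n → a n ℚ.+ b n)
+-isCauchy a b ca cb ε ε>0 =
  let ε/2>0   = subst (ℚ._< ½ ℚ.* ε) (ℚ.*-zeroʳ ½) (ℚ.*-monoʳ-<-pos ½ ε>0)
      M , ca′ = ca (½ ℚ.* ε) ε/2>0
      N , cb′ = cb (½ ℚ.* ε) ε/2>0
  in M ℕ.⊔ N , λ m n m≥ n≥ →
    subst (λ q → ∣ q ∣ ℚ.< ε) (rearrange (a m) (a n) (b m) (b n))
      (ℚ.≤-<-trans (ℚ.∣p+q∣≤∣p∣+∣q∣ (a m ℚ.- a n) (b m ℚ.- b n))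
        (subst (∣ a m ℚ.- a n ∣ ℚ.+ ∣ b m ℚ.- b n ∣ ℚ.<_) (halves ε)
          (ℚ.+-mono-<
            (ca′ m n (ℕ.m⊔n≤o⇒m≤o M N m≥) (ℕ.m⊔n≤o⇒m≤o M N n≥))
            (cb′ m n (ℕ.m⊔n≤o⇒n≤o M N m≥) (ℕ.m⊔n≤o⇒n≤o M N n≥)))))
  where
  open +-*-Solver

  rearrange : ∀ p q r s → (p ℚ.- q) ℚ.+ (r ℚ.- s) ≡ (p ℚ.+ r) ℚ.- (q ℚ.+ s)
  rearrange = solve 4 (λ p q r s → (p :- q) :+ (r :- s) := (p :+ r) :- (q :+ s)) refl

  halves : ∀ p → ½ ℚ.* p ℚ.+ ½ ℚ.* p ≡ p
  halves = solve 1 (λ p → con ½ :* p :+ con ½ :* p := p) refl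

_+_ : ℝ → ℝ → ℝ
x + y = mkℝ (λ n → seq x n ℚ.+ seq y n) (+-isCauchy (seq x) (seq y) (cauchy x) (cauchy y))

_≤_ : ℝ → ℝ → Set
x ≤ y = ∀ ε → 0ℚ ℚ.< ε →
  ∃ λ N → ∀ n → N ℕ.≤ n → seq x n ℚ.≤ seq y n ℚ.+ ε

_≈_ : ℝ → ℝ → Set
x ≈ y = x ≤ y × y ≤ x

-- A finite ground set with n elements is Fin n, and a function 2^V → ℝ is a
-- function on Subset n.

SetFunction : ℕ → Set
SetFunction n = Subset n → ℝ

Family : ℕ → Set₁
Family n = Pred (Subset n) 0ℓ

Intersecting : ∀ {n} → Subset n → Subset n → Set
Intersecting A B = Nonempty (A ─ B) × Nonempty (B ─ A) × Nonempty (A ∩ B)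

Crossing : ∀ {n} → Subset n → Subset n → Set
Crossing A B =
  Nonempty (A ─ B) × Nonempty (B ─ A) × Nonempty (A ∩ B) × Nonempty (∁ (A ∪ B))

IntersectingSubmodular : ∀ {n} → SetFunction n → Set
IntersectingSubmodular f =
  ∀ A B → Intersecting A B → f (A ∪ B) + f (A ∩ B) ≤ f A + f B

IntersectingPosimodular : ∀ {n} → SetFunction n → Set
IntersectingPosimodular f =
  ∀ A B → Intersecting A B → f (A ─ B) + f (B ─ A) ≤ f A + f B

CrossingSubmodular : ∀ {n} → SetFunction n → Set
CrossingSubmodular g =
  ∀ A B → Crossing A B → g (A ∪ B) + g (A ∩ B) ≤ g A + g B

Symmetric : ∀ {n} → SetFunction n → Set
Symmetric g = ∀ A → g A ≈ g (∁ A)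

Hereditary : ∀ {n} → Family n → Set
Hereditary 𝓘 = ∀ {A B} → 𝓘 A → B ⊆ A → 𝓘 B

Optimal : ∀ {n} → SetFunction n → Family n → Family n
Optimal h 𝓘 A =
  Nonempty A × 𝓘 A × (∀ B → Nonempty B → 𝓘 B → h A ≤ h B)

MinimalOptimal : ∀ {n} → SetFunction n → Family n → Family n
MinimalOptimal h 𝓘 A =
  Optimal h 𝓘 A × (∀ B → B ⊂ A → ¬ Optimal h 𝓘 B)

-- For V = Fin n, the set V + s is Fin (suc n): s is zero and v ∈ V is suc v.
-- Thus outside ∷ X is X ⊆ V seen as a subset of V + s, and inside ∷ X is X + s.

-- In the second case V ∖ (X + s) = V ∖ X.
antirestriction : ∀ {n} → SetFunction n → SetFunction (suc n)
antirestriction f (outside ∷ X) = f X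
antirestriction f (inside  ∷ X) = f (∁ X)

-- A family of subsets of V, seen as a family of subsets of V + s.
infix 8 _⁺

_⁺ : ∀ {n} → Family n → Family (suc n)
(𝓘 ⁺) X = ∃ λ A → 𝓘 A × X ≡ outside ∷ A

-- Deterministic value-oracle algorithms on the ground set Fin m, as finite
-- decision trees.  Program m k is the remaining computation after k oracle
-- answers.  Only the calls of the value oracle are counted: branching may use
-- any property of the answers received so far (in particular any arithmetic
-- and comparisons) and any membership test for the family.
data Program (m : ℕ) : ℕ → Set₁ where
  output : ∀ {k} → List (Subset m) → Program m k
  query  : ∀ {k} → Subset m → Program m (suc k) → Program m k
  branch : ∀ {k} → Pred (Vec ℝ k) 0ℓ → Program m k → Program m k → Program m k
  member : ∀ {k} → Subset m → Program m k → Program m k → Program m k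

Algorithm : Set₁
Algorithm = ∀ m → Program m 0

-- Run h 𝓘 as p out c: given the earlier answers as (latest first), p executed
-- on the system with function h and family 𝓘 outputs out after c further calls
-- of the value oracle of h.
data Run {m} (h : SetFunction m) (𝓘 : Family m) :
         ∀ {k} → Vec ℝ k → Program m k → List (Subset m) → ℕ → Set₁ where
  output     : ∀ {k} {as : Vec ℝ k} {out} →
               Run h 𝓘 as (output out) out 0
  query      : ∀ {k} {as : Vec ℝ k} {X p out c} →
               Run h 𝓘 (h X ∷ as) p out c →
               Run h 𝓘 as (query X p) out (suc c)
  branch-yes : ∀ {k} {as : Vec ℝ k} {P p q out c} →
               P as → Run h 𝓘 as p out c →
               Run h 𝓘 as (branch P p q) out c
  branch-no  : ∀ {k} {as : Vec ℝ k} {P p q out c} →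
               ¬ P as → Run h 𝓘 as q out c →
               Run h 𝓘 as (branch P p q) out c
  member-yes : ∀ {k} {as : Vec ℝ k} {X p q out c} →
               𝓘 X → Run h 𝓘 as p out c →
               Run h 𝓘 as (member X p q) out c
  member-no  : ∀ {k} {as : Vec ℝ k} {X p q out c} →
               ¬ 𝓘 X → Run h 𝓘 as q out c →
               Run h 𝓘 as (member X p q) out c

-- Executed on (h, 𝓘), p outputs a list of exactly the members of 𝓢, with at
-- most b oracle calls.  Classically a program has exactly one run; its
-- existence is stated under ¬ ¬ because branching conditions on reals and
-- membership in a family need not be decidable.
Returns : ∀ {m} → SetFunction m → Family m → Program m 0 → Family m → ℕ → Set₁
Returns h 𝓘 p 𝓢 b =
  (¬ ¬ (∃₂ λ out c → Run h 𝓘 [] p out c)) ×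
  (∀ out c → Run h 𝓘 [] p out c → ((_∈ˡ out) ≐ 𝓢) × c ℕ.≤ b)

FindsMinimalOptimal : Algorithm → (ℕ → ℕ) → Set₁
FindsMinimalOptimal 𝓐 b =
  ∀ m (h : SetFunction m) (𝓘 : Family m) →
  Symmetric h → CrossingSubmodular h → Hereditary 𝓘 →
  Returns h 𝓘 (𝓐 m) (MinimalOptimal h 𝓘) (b m)

BigOCubic : (ℕ → ℕ) → Set
BigOCubic b = ∃₂ λ C N → ∀ m → N ℕ.≤ m → b m ℕ.≤ C ℕ.* m ℕ.^ 3

{-# OPTIONS --safe #-}

-- On sets avoiding s, crossing for V + s is intersecting for V, and g agrees
-- with f; on sets containing s, g is f of the complement, so crossing
-- submodularity is intersecting submodularity for the complements.  If exactly
-- one of A, B contains s, say A, then with C = V ∖ A the inequality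
-- g (A ∪ B) + g (A ∩ B) ≤ g A + g B is posimodularity
-- f (C ∖ B) + f (B ∖ C) ≤ f C + f B.
module Submission where

open import Defs
open import Algebra.Lattice.Properties.BooleanAlgebra using (¬-involutive; deMorgan₁; deMorgan₂)
open import Data.Fin using (suc)
open import Data.Fin.Subset
  using (Subset; inside; outside; Nonempty; _⊂_; _∩_; _∪_; _─_; ∁)
open import Data.Fin.Subset.Properties
  using (∪-∩-booleanAlgebra; ∪-comm; ∩-comm; out⊂; drop-∷-⊆; drop-∷-⊂)
open import Data.Nat using (ℕ; suc)
open import Data.Product using (_×_; _,_; proj₁; proj₂)
import Data.Rational as ℚ
import Data.Rational.Properties as ℚ
open import Data.Vec using ([]; _∷_; here; there)
open import Relation.Binary.PropositionalEquality
  using (_≡_; refl; sym; trans; cong; subst; subst₂; module ≡-Reasoning)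
open import Relation.Nullary using (¬_)
open import Relation.Unary using (_≐_)
open import Relation.Unary.Properties using (≐-trans)

≤-refl : ∀ x → x ≤ x
≤-refl x ε ε>0 = 0 , λ n _ →
  subst (ℚ._≤ seq x n ℚ.+ ε) (ℚ.+-identityʳ (seq x n)) (ℚ.+-monoʳ-≤ (seq x n) (ℚ.<⇒≤ ε>0))

≈-reflexive : ∀ {x y} → x ≡ y → x ≈ y
≈-reflexive {x} refl = ≤-refl x , ≤-refl x

-- `x + y` and `y + x` carry different sequences and Cauchy proofs, so commutativity is applied to
-- the rational terms inside `≤` rather than as an equation in `ℝ`.
+-swapˡ-≤ : ∀ x y z → x + y ≤ z → y + x ≤ z
+-swapˡ-≤ x y z x+y≤z ε ε>0 with x+y≤z ε ε>0
... | N , bound = N , λ n N≤n →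
  subst (ℚ._≤ seq z n ℚ.+ ε) (ℚ.+-comm (seq x n) (seq y n)) (bound n N≤n)

+-swapʳ-≤ : ∀ x y z → z ≤ x + y → z ≤ y + x
+-swapʳ-≤ x y z z≤x+y ε ε>0 with z≤x+y ε ε>0
... | N , bound = N , λ n N≤n →
  subst (λ q → seq z n ℚ.≤ q ℚ.+ ε) (ℚ.+-comm (seq x n) (seq y n)) (bound n N≤n)

module _ {n : ℕ} where

  ∁-involutive : (p : Subset n) → ∁ (∁ p) ≡ p
  ∁-involutive = ¬-involutive (∪-∩-booleanAlgebra n)

  ∁-∩ : (p q : Subset n) → ∁ (p ∩ q) ≡ ∁ p ∪ ∁ q
  ∁-∩ = deMorgan₁ (∪-∩-booleanAlgebra n)

  ∁-∪ : (p q : Subset n) → ∁ (p ∪ q) ≡ ∁ p ∩ ∁ q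
  ∁-∪ = deMorgan₂ (∪-∩-booleanAlgebra n)

-- Brings `─` into the Boolean algebra, so that the identities below follow from De Morgan, double
-- complement and commutativity.
p─q≡p∩∁q : ∀ {n} (p q : Subset n) → p ─ q ≡ p ∩ ∁ q
p─q≡p∩∁q []            []            = refl
p─q≡p∩∁q (inside  ∷ p) (inside  ∷ q) = cong (outside ∷_) (p─q≡p∩∁q p q)
p─q≡p∩∁q (inside  ∷ p) (outside ∷ q) = cong (inside  ∷_) (p─q≡p∩∁q p q)
p─q≡p∩∁q (outside ∷ p) (inside  ∷ q) = cong (outside ∷_) (p─q≡p∩∁q p q)
p─q≡p∩∁q (outside ∷ p) (outside ∷ q) = cong (outside ∷_) (p─q≡p∩∁q p q)

∁p─q≡∁[p∪q] : ∀ {n} (p q : Subset n) → ∁ p ─ q ≡ ∁ (p ∪ q)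
∁p─q≡∁[p∪q] p q = trans (p─q≡p∩∁q (∁ p) q) (sym (∁-∪ p q))

∁p∩q≡q─p : ∀ {n} (p q : Subset n) → ∁ p ∩ q ≡ q ─ p
∁p∩q≡q─p p q = trans (∩-comm (∁ p) q) (sym (p─q≡p∩∁q q p))

q─∁p≡p∩q : ∀ {n} (p q : Subset n) → q ─ ∁ p ≡ p ∩ q
q─∁p≡p∩q p q = begin
  q ─ ∁ p      ≡⟨ ∁p∩q≡q─p (∁ p) q ⟨
  ∁ (∁ p) ∩ q  ≡⟨ cong (_∩ q) (∁-involutive p) ⟩
  p ∩ q        ∎
  where open ≡-Reasoning

∁p─∁q≡q─p : ∀ {n} (p q : Subset n) → ∁ p ─ ∁ q ≡ q ─ p
∁p─∁q≡q─p p q = trans (q─∁p≡p∩q q (∁ p)) (sym (p─q≡p∩∁q q p))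

drop-outside : ∀ {n} {p : Subset n} → Nonempty (outside ∷ p) → Nonempty p
drop-outside (suc x , there x∈p) = x , x∈p

add-outside : ∀ {n} {p : Subset n} → Nonempty p → Nonempty (outside ∷ p)
add-outside (x , x∈p) = suc x , there x∈p

module _ {n} (f : SetFunction n) where

  antirestriction-symmetric : Symmetric (antirestriction f)
  -- Complementing toggles `s`, so the other side is `f (∁ (∁ A))`; when `s` is present both sides
  -- are `f (∁ A)` by computation.
  antirestriction-symmetric (outside ∷ A) = ≈-reflexive (cong f (sym (∁-involutive A)))
  antirestriction-symmetric (inside  ∷ A) = ≈-reflexive {f (∁ A)} refl

  -- `∁ A` and `∁ B` meet in `∁ (A ∪ B)`, so they intersect because `A ∪ B` misses a point.
  -- Complementing exchanges union and intersection, which reverses the summands on the left.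
  submodular-∁ : IntersectingSubmodular f → ∀ A B →
    Nonempty (A ─ B) → Nonempty (B ─ A) → Nonempty (∁ (A ∪ B)) →
    f (∁ (A ∪ B)) + f (∁ (A ∩ B)) ≤ f (∁ A) + f (∁ B)
  submodular-∁ sub A B A─B B─A ∁A∪B =
    +-swapˡ-≤ (f (∁ (A ∩ B))) (f (∁ (A ∪ B))) (f (∁ A) + f (∁ B))
      (subst₂ (λ X Y → f X + f Y ≤ f (∁ A) + f (∁ B)) (sym (∁-∩ A B)) (sym (∁-∪ A B))
        (sub (∁ A) (∁ B)
          ( subst Nonempty (sym (∁p─∁q≡q─p A B)) B─A
          , subst Nonempty (sym (∁p─∁q≡q─p B A)) A─B
          , subst Nonempty (∁-∪ A B) ∁A∪B)))

  -- For `∁ A` and `B` the two differences are `∁ (A ∪ B)` and `A ∩ B`, and the intersection is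
  -- `B ─ A`: the three sets assumed nonempty.
  posimodular-∁ : IntersectingPosimodular f → ∀ A B →
    Nonempty (B ─ A) → Nonempty (A ∩ B) → Nonempty (∁ (A ∪ B)) →
    f (∁ (A ∪ B)) + f (A ∩ B) ≤ f (∁ A) + f B
  posimodular-∁ pos A B B─A A∩B ∁A∪B =
    subst₂ (λ X Y → f X + f Y ≤ f (∁ A) + f B) (∁p─q≡∁[p∪q] A B) (q─∁p≡p∩q A B)
      (pos (∁ A) B
        ( subst Nonempty (sym (∁p─q≡∁[p∪q] A B)) ∁A∪B
        , subst Nonempty (sym (q─∁p≡p∩q A B)) A∩B
        , subst Nonempty (sym (∁p∩q≡q─p A B)) B─A))

  antirestriction-crossingSubmodular :
    IntersectingSubmodular f → IntersectingPosimodular f →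
    CrossingSubmodular (antirestriction f)
  antirestriction-crossingSubmodular sub pos (outside ∷ A) (outside ∷ B) (A─B , B─A , A∩B , _) =
    sub A B (drop-outside A─B , drop-outside B─A , drop-outside A∩B)
  antirestriction-crossingSubmodular sub pos (inside ∷ A) (inside ∷ B) (A─B , B─A , _ , ∁A∪B) =
    submodular-∁ sub A B (drop-outside A─B) (drop-outside B─A) (drop-outside ∁A∪B)
  antirestriction-crossingSubmodular sub pos (inside ∷ A) (outside ∷ B) (_ , B─A , A∩B , ∁A∪B) =
    posimodular-∁ pos A B (drop-outside B─A) (drop-outside A∩B) (drop-outside ∁A∪B)
  antirestriction-crossingSubmodular sub pos (outside ∷ A) (inside ∷ B) (A─B , _ , A∩B , ∁A∪B)
    -- The previous case with `A` and `B` exchanged; the rewriting handles the left side, the swap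
    -- the sum on the right.
    rewrite ∪-comm A B | ∩-comm A B =
    +-swapʳ-≤ (f (∁ B)) (f A) (f (∁ (B ∪ A)) + f (B ∩ A))
      (posimodular-∁ pos B A (drop-outside A─B) (drop-outside A∩B) (drop-outside ∁A∪B))

  -- All competitors in `𝓘 ⁺` avoid `s`, and there the antirestriction computes to `f`, so the
  -- inequalities carry over unchanged.
  optimal-antirestriction : ∀ 𝓘 → Optimal (antirestriction f) (𝓘 ⁺) ≐ (Optimal f 𝓘) ⁺
  optimal-antirestriction 𝓘 = to , from
    where
    to : ∀ {X} → Optimal (antirestriction f) (𝓘 ⁺) X → (Optimal f 𝓘 ⁺) X
    to (ne , (A , A∈𝓘 , refl) , least) =
      A , (drop-outside ne , A∈𝓘 ,
           λ B neB B∈𝓘 → least (outside ∷ B) (add-outside neB) (B , B∈𝓘 , refl)) , refl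

    from : ∀ {X} → (Optimal f 𝓘 ⁺) X → Optimal (antirestriction f) (𝓘 ⁺) X
    from (A , (ne , A∈𝓘 , least) , refl) =
      add-outside ne , (A , A∈𝓘 , refl) ,
      λ { _ neB (B , B∈𝓘 , refl) → least B (drop-outside neB) B∈𝓘 }

  minimalOptimal-antirestriction : ∀ 𝓘 →
    MinimalOptimal (antirestriction f) (𝓘 ⁺) ≐ (MinimalOptimal f 𝓘) ⁺
  minimalOptimal-antirestriction 𝓘 = to , from
    where
    lower = proj₁ (optimal-antirestriction 𝓘)
    lift  = proj₂ (optimal-antirestriction 𝓘)

    to : ∀ {X} → MinimalOptimal (antirestriction f) (𝓘 ⁺) X → (MinimalOptimal f 𝓘 ⁺) X
    to (opt , minimal) with lower opt
    ... | A , optA , refl =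
      A , (optA , λ B B⊂A optB → minimal (outside ∷ B) (out⊂ B⊂A) (lift (B , optB , refl))) , refl

    from : ∀ {X} → (MinimalOptimal f 𝓘 ⁺) X → MinimalOptimal (antirestriction f) (𝓘 ⁺) X
    from (A , (optA , minimal) , refl) = lift (A , optA , refl) , minimal⁺
      where
      minimal⁺ : ∀ B → B ⊂ outside ∷ A →
                 ¬ Optimal (antirestriction f) (𝓘 ⁺) B
      minimal⁺ B B⊂A optB with lower optB
      -- An optimal `B` lies in `𝓘 ⁺`, hence is `outside ∷ C` and contradicts the minimality of `A`.
      ... | C , optC , refl = minimal C (drop-∷-⊂ B⊂A) optC

⁺-hereditary : ∀ {n} {𝓘 : Family n} → Hereditary 𝓘 → Hereditary (𝓘 ⁺)
⁺-hereditary her {B = outside ∷ B} (A , A∈𝓘 , refl) B⊆A = B , her A∈𝓘 (drop-∷-⊆ B⊆A) , refl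
-- A subset containing `s` would put `s` into `outside ∷ A`.
⁺-hereditary her {B = inside  ∷ B} (A , A∈𝓘 , refl) B⊆A with B⊆A here
... | ()

Returns-resp-≐ : ∀ {m} {h : SetFunction m} {𝓘 p 𝓢 𝓣 b} →
  𝓢 ≐ 𝓣 → Returns h 𝓘 p 𝓢 b → Returns h 𝓘 p 𝓣 b
Returns-resp-≐ 𝓢≐𝓣 (halts , correct) = halts , λ out c run →
  let out≐𝓢 , c≤b = correct out c run in ≐-trans out≐𝓢 𝓢≐𝓣 , c≤b

mainTheorem5 : ∀ {n : ℕ} (f : SetFunction n) →
    IntersectingSubmodular f → IntersectingPosimodular f →
    (Symmetric (antirestriction f) × CrossingSubmodular (antirestriction f)) ×
    (∀ (𝓘 : Family n) → Hereditary 𝓘 →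
    (Optimal (antirestriction f) (𝓘 ⁺) ≐ (Optimal f 𝓘) ⁺) ×
    (∀ (𝓐 : Algorithm) (b : ℕ → ℕ) → BigOCubic b → FindsMinimalOptimal 𝓐 b →
    Returns (antirestriction f) (𝓘 ⁺) (𝓐 (suc n)) ((MinimalOptimal f 𝓘) ⁺) (b (suc n))))
mainTheorem5 {n} f sub pos = (symmetric , crossing) , λ 𝓘 her →
  optimal-antirestriction f 𝓘 , λ 𝓐 b _ finds →
    Returns-resp-≐ (minimalOptimal-antirestriction f 𝓘)
      -- The ground set is `V + s`, with `suc n` elements, hence the call bound `b (suc n)`.
      (finds (suc n) (antirestriction f) (𝓘 ⁺) symmetric crossing (⁺-hereditary her))
  where
  symmetric = antirestriction-symmetric f
  crossing  = antirestriction-crossingSubmodular f sub pos
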